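{- Let $a,b,n\ge1$ be integers. Then the Horadam cube $\Pi^{a,b}_n$ contains a Hamiltonian path.
   Context: For integers $a,b\ge1$ and $n\ge 0$, $\mathcal S^{a,b}_n$ is the set of all strings of length $n$ over the alphabet $\{0,1,\dots,a+b-1\}$ in which every letter from $\{a,\dots,a+b-1\}$ appears only immediately after a letter $0$. The Horadam cube $\Pi^{a,b}_n$ is the simple graph with vertex set $\mathcal S^{a,b}_n$ in which $x_1\cdots x_n$ and $y_1\cdots y_n$ are adjacent if and only if $\sum_{i=1}^n|x_i-y_i|=1$. A Hamiltonian path is a path visiting each vertex exactly once. -}

module Defs where

open import Data.Fin.Base using (Fin; toℕ)
open import Data.List.Base using (List)
open import Data.List.Membership.Propositional using (_∈_)
open import Data.List.Relation.Unary.Linked using (Linked)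
open import Data.List.Relation.Unary.Unique.Propositional using (Unique)
open import Data.Nat.Base using (ℕ; suc; _+_; _≤_; ∣_-_∣)
open import Data.Nat.Properties using (∣-∣-comm; ∣n-n∣≡0)
open import Data.Product.Base using (_×_; ∃-syntax)
open import Data.Vec.Base using (Vec; []; _∷_; lookup; sum; zipWith)
open import Relation.Binary.PropositionalEquality
  using (_≡_; refl; sym; trans; cong₂)
open import Relation.Nullary.Negation.Core using (¬_)

record SimpleGraph : Set₁ where
  field
    Vertex     : Set
    Adj        : Vertex → Vertex → Set
    Adj-sym    : ∀ {u v} → Adj u v → Adj v u
    Adj-irrefl : ∀ {v} → ¬ Adj v v

record IsHamiltonianPath (G : SimpleGraph) (vs : List (SimpleGraph.Vertex G)) : Set where
  open SimpleGraph G
  field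
    consecutive-adjacent : Linked Adj vs
    no-repetition        : Unique vs
    visits-all           : ∀ (v : Vertex) → v ∈ vs

HasHamiltonianPath : SimpleGraph → Set
HasHamiltonianPath G = ∃[ vs ] IsHamiltonianPath G vs

-- The positions of the string are 0, …, n - 1; in particular the letter at
-- position 0 has no predecessor, so it must be smaller than a.
LargeOnlyAfterZero : (a b : ℕ) {n : ℕ} → Vec (Fin (a + b)) n → Set
LargeOnlyAfterZero a b {n} x =
  ∀ (i : Fin n) → a ≤ toℕ (lookup x i) →
  ∃[ j ] (toℕ i ≡ suc (toℕ j) × toℕ (lookup x j) ≡ 0)

-- The proof of the constraint is irrelevant, so that two elements are equal
-- as soon as their underlying strings are.
record HoradamString (a b n : ℕ) : Set where
  constructor mkHoradamString
  field
    string      : Vec (Fin (a + b)) n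
    .constraint : LargeOnlyAfterZero a b string

open HoradamString public using (string)

distance : ∀ {k n} → Vec (Fin k) n → Vec (Fin k) n → ℕ
distance x y = sum (zipWith (λ p q → ∣ toℕ p - toℕ q ∣) x y)

distance-comm : ∀ {k n} (x y : Vec (Fin k) n) → distance x y ≡ distance y x
distance-comm []      []      = refl
distance-comm (p ∷ x) (q ∷ y) =
  cong₂ _+_ (∣-∣-comm (toℕ p) (toℕ q)) (distance-comm x y)

distance-self : ∀ {k n} (x : Vec (Fin k) n) → distance x x ≡ 0
distance-self []      = refl
distance-self (p ∷ x) = cong₂ _+_ (∣n-n∣≡0 (toℕ p)) (distance-self x)

horadamCube : (a b n : ℕ) → SimpleGraph
horadamCube a b n = record
  { Vertex     = HoradamString a b n
  ; Adj        = λ u v → distance (string u) (string v) ≡ 1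
  ; Adj-sym    = λ {u} {v} uv → trans (distance-comm (string v) (string u)) uv
  ; Adj-irrefl = λ {v} vv → 0≢1 (trans (sym (distance-self (string v))) vv)
  }
  where
  0≢1 : ¬ (0 ≡ 1)
  0≢1 ()

{-# OPTIONS --safe #-}
-- Let T m be the set of strings of length m that may follow a letter 0, so
-- that every first letter is allowed, and S m the set of Horadam strings.
-- Then T (m+1) is the union of 0 · T m and of k · S m for 0 < k < a + b, and
-- S (m+1) is the same union restricted to k < a.  Traverse 0 · T m backwards
-- along a path of T m, ending at 0 s, and then 1 · S m, 2 · S m, … alternately
-- forwards and backwards along a path of S m.  This works as soon as the two
-- paths start at the same string s, and the two resulting paths again share
-- their start, since both begin with the traversal of 0 · T m.
module Submission where

open import Data.Fin.Base using (Fin; zero; suc; toℕ; fromℕ<; inject₁; _↑ˡ_)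
open import Data.Fin.Properties
  using (_≟_; toℕ<n; toℕ-inject₁; toℕ-injective; toℕ-fromℕ<; toℕ-↑ˡ; ↑ˡ-injective)
open import Data.List.Base using (List; []; _∷_; [_]; _++_; map; reverse; tabulate)
open import Data.List.Properties using (unfold-reverse; ++-assoc; ++-identityʳ)
open import Data.List.Membership.Propositional using (_∈_)
open import Data.List.Membership.Propositional.Properties
  using (∈-map⁺; ∈-map⁻; ∈-++⁺ˡ; ∈-++⁺ʳ; ∈-++⁻; ∈-tabulate⁺; ∈-tabulate⁻)
import Data.List.Membership.DecPropositional as DecMembership
open import Data.List.Relation.Binary.Permutation.Propositional using (↭-sym; ↭⇒↭ₛ)
open import Data.List.Relation.Binary.Permutation.Propositional.Properties using (↭-reverse)
open import Data.List.Relation.Binary.Permutation.Setoid.Properties using (Unique-resp-↭)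
open import Data.List.Relation.Binary.Subset.Propositional using (_⊆_)
open import Data.List.Relation.Unary.All using (All; []; _∷_)
import Data.List.Relation.Unary.All as All
open import Data.List.Relation.Unary.AllPairs using ([]; _∷_)
open import Data.List.Relation.Unary.Any using (here; there)
open import Data.List.Relation.Unary.Any.Properties using (reverse⁺; reverse⁻)
open import Data.List.Relation.Unary.Linked using (Linked; [-]; _∷_)
import Data.List.Relation.Unary.Linked.Properties as Linkedₚ
open import Data.List.Relation.Unary.Unique.Propositional using (Unique)
import Data.List.Relation.Unary.Unique.Propositional.Properties as Uniqueₚ
open import Data.Nat.Base using (ℕ; zero; suc; _+_; _≤_; _<_; s≤s; ∣_-_∣)
open import Data.Nat.Properties using (∣n-n∣≡0; suc-injective; <⇒≱; ≰⇒>; _≤?_)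
open import Data.Product.Base using (_×_; _,_; ∃-syntax; proj₁; proj₂)
open import Data.Sum.Base using (_⊎_; inj₁; inj₂)
open import Data.Vec.Base using (Vec; []; _∷_; lookup)
open import Data.Vec.Properties using (∷-injectiveʳ; ≡-dec)
open import Function.Base using (_∘_; id)
open import Level using (Level)
open import Relation.Binary.Core using (Rel)
open import Relation.Binary.Definitions using (Symmetric)
open import Relation.Binary.PropositionalEquality
  using (_≡_; refl; sym; trans; cong; cong₂; subst; setoid)
open import Relation.Nullary.Decidable using (yes; no; recompute)
open import Relation.Nullary.Negation using (contradiction)
open import Defs

-- Walks with recorded endpoints.

private
  variable
    ℓ : Level
    A B : Set
    n : ℕ

-- With both endpoints as indices, joining two walks asks only for one step between them, and
-- reversal swaps the indices.
data Walk {A : Set} (R : Rel A ℓ) : A → A → List A → Set ℓ where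
  [-] : ∀ {x} → Walk R x x [ x ]
  _∷_ : ∀ {x y z xs} → R x y → Walk R y z xs → Walk R x z (x ∷ xs)

module _ {R : Rel A ℓ} where

  Walk⇒Linked : ∀ {x y xs} → Walk R x y xs → Linked R xs
  Walk⇒Linked [-]            = [-]
  Walk⇒Linked (r ∷ [-])      = r ∷ [-]
  Walk⇒Linked (r ∷ w@(_ ∷ _)) = r ∷ Walk⇒Linked w

  Walk-++⁺ : ∀ {w x y z xs ys} →
             Walk R w x xs → R x y → Walk R y z ys → Walk R w z (xs ++ ys)
  Walk-++⁺ [-]     r v = r ∷ v
  Walk-++⁺ (q ∷ w) r v = q ∷ Walk-++⁺ w r v

  Walk-reverse⁺ : Symmetric R → ∀ {x y xs} → Walk R x y xs → Walk R y x (reverse xs)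
  Walk-reverse⁺ R-sym [-] = [-]
  Walk-reverse⁺ R-sym {xs = x ∷ xs} (r ∷ w) =
    subst (Walk R _ _) (sym (unfold-reverse x xs))
      (Walk-++⁺ (Walk-reverse⁺ R-sym w) (R-sym r) [-])

Walk-map⁺ : {R : Rel A ℓ} {S : Rel B ℓ} {f : A → B} →
            (∀ {x y} → R x y → S (f x) (f y)) →
            ∀ {x y xs} → Walk R x y xs → Walk S (f x) (f y) (map f xs)
Walk-map⁺ hom [-]     = [-]
Walk-map⁺ hom (r ∷ w) = hom r ∷ Walk-map⁺ hom w

Linked-tabulate⁺ : {R : Rel A ℓ} (f : Fin (suc n) → A) →
                   (∀ i → R (f (inject₁ i)) (f (suc i))) → Linked R (tabulate f)
Linked-tabulate⁺ {n = zero}  f r = [-]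
Linked-tabulate⁺ {n = suc n} f r = r zero ∷ Linked-tabulate⁺ (f ∘ suc) (r ∘ suc)

Unique-reverse⁺ : {xs : List A} → Unique xs → Unique (reverse xs)
Unique-reverse⁺ {xs = xs} =
  Unique-resp-↭ (setoid _) (↭⇒↭ₛ (↭-sym (↭-reverse xs)))

-- Closeness of strings and the zigzag traversal of blocks.

_~_ : ∀ {K} → Rel (Fin K) _
p ~ q = ∣ toℕ p - toℕ q ∣ ≡ 1

Close : ∀ {K} → Rel (Vec (Fin K) n) _
Close x y = distance x y ≡ 1

Close-sym : ∀ {K} → Symmetric (Close {n} {K})
Close-sym {x = x} {y = y} xy = trans (distance-comm y x) xy

Close-∷ : ∀ {K} (k : Fin K) {x y : Vec (Fin K) n} → Close x y → Close (k ∷ x) (k ∷ y)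
Close-∷ k = trans (cong (_+ _) (∣n-n∣≡0 (toℕ k)))

Close-∷ˡ : ∀ {K} (k l : Fin K) → k ~ l → (x : Vec (Fin K) n) → Close (k ∷ x) (l ∷ x)
Close-∷ˡ k l kl x = cong₂ _+_ kl (distance-self x)

-- Reversing `xs` after each letter makes neighbouring blocks meet at a common tail, so that passing
-- between them changes only the first letter.
zigzag : List A → List (Vec A n) → List (Vec A (suc n))
zigzag []       xs = []
zigzag (k ∷ ks) xs = map (k ∷_) xs ++ zigzag ks (reverse xs)

zigzag⁺ : ∀ {k} {x : Vec A n} ks {xs} → k ∈ ks → x ∈ xs → k ∷ x ∈ zigzag ks xs
zigzag⁺ (k ∷ ks)      (here refl) x∈ = ∈-++⁺ˡ (∈-map⁺ (k ∷_) x∈)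
zigzag⁺ (k ∷ ks) {xs} (there k∈)  x∈ = ∈-++⁺ʳ (map (k ∷_) xs) (zigzag⁺ ks k∈ (reverse⁺ x∈))

zigzag⁻ : ∀ {k} {x : Vec A n} ks {xs} → k ∷ x ∈ zigzag ks xs → k ∈ ks × x ∈ xs
zigzag⁻ (l ∷ ks) {xs} kx∈ with ∈-++⁻ (map (l ∷_) xs) kx∈
... | inj₁ kx∈ˡ with _ , x∈ , refl ← ∈-map⁻ (l ∷_) kx∈ˡ = here refl , x∈
... | inj₂ kx∈ʳ with k∈ , x∈ ← zigzag⁻ ks kx∈ʳ = there k∈ , reverse⁻ x∈

-- Different blocks differ in their first letter. The first block has its own list `xs` because the
-- block of 0 runs over other tails than the rest.
block++zigzag-unique : ∀ {k} {ks : List A} {xs ys : List (Vec A n)} →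
  Unique (k ∷ ks) → Unique xs → Unique ys → Unique (map (k ∷_) xs ++ zigzag ks ys)
block++zigzag-unique {k = k} {ks} {xs} {ys} (k∉ks ∷ ks!) xs! ys! =
  Uniqueₚ.++⁺ (Uniqueₚ.map⁺ ∷-injectiveʳ xs!) (zigzag! ks!) disjoint
  where
  zigzag! : ∀ {ls} → Unique ls → Unique (zigzag ls ys)
  zigzag! []         = []
  zigzag! ls!@(_ ∷ _) = block++zigzag-unique ls! ys! (Unique-reverse⁺ ys!)

  disjoint : ∀ {x} → x ∈ map (k ∷_) xs × x ∈ zigzag ks ys → _
  disjoint (x∈ˡ , x∈ʳ) with _ , _ , refl ← ∈-map⁻ (k ∷_) x∈ˡ =
    All.lookup k∉ks (proj₁ (zigzag⁻ ks x∈ʳ)) refl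

-- Induction on `ks`, with `us` accumulating the walk made so far. It stops over the tail `x` where
-- the next block starts; that block ends over `y`, where the reversed walk starts. The final
-- endpoint depends on the parity of the number of blocks, hence the existential.
zigzag-walk : ∀ {K} {k : Fin K} {ks u} {x y : Vec (Fin K) n} {us xs} →
  Linked _~_ (k ∷ ks) → Walk Close u (k ∷ x) us → Walk Close x y xs →
  ∃[ v ] Walk Close u v (us ++ zigzag ks xs)
zigzag-walk {ks = []} {us = us} _ wᵤ _ =
  _ , subst (Walk Close _ _) (sym (++-identityʳ us)) wᵤ
zigzag-walk {k = k} {ks = l ∷ ks} {x = x} {us = us} {xs = xs} (kl ∷ ls) wᵤ w
  with v , wᵥ ← zigzag-walk ls
         (Walk-++⁺ wᵤ (Close-∷ˡ k l kl x) (Walk-map⁺ (λ {p} {q} → Close-∷ l {p} {q}) w))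
         (Walk-reverse⁺ (λ {p} {q} → Close-sym {x = p} {q}) w)
  = v , subst (Walk Close _ _) (++-assoc us (map (l ∷_) xs) (zigzag ks (reverse xs))) wᵥ

-- After a letter 0 the nonzero letters in `all` are allowed, after any other
-- letter those in `small`; `ks` are the nonzero letters allowed at the start.
module Paths {K} (all small : List (Fin (suc K))) where

  data Admissible (ks : List (Fin (suc K))) : Vec (Fin (suc K)) n → Set where
    []     : Admissible ks []
    zero∷_ : {x : Vec _ n} → Admissible all x → Admissible ks (zero ∷ x)
    _∷_    : ∀ {k} {x : Vec _ n} → k ∈ ks → Admissible small x → Admissible ks (k ∷ x)

  path : List (Fin (suc K)) → ∀ n → List (Vec (Fin (suc K)) n)
  path ks zero    = [ [] ]
  path ks (suc n) = map (zero ∷_) (reverse (path all n)) ++ zigzag ks (path small n)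

  path-sound : ∀ {ks} {x : Vec _ n} → x ∈ path ks n → Admissible ks x
  path-sound {zero}  {x = []} _ = []
  path-sound {suc n} {ks} {k ∷ x} kx∈ with ∈-++⁻ (map (zero ∷_) (reverse (path all n))) kx∈
  ... | inj₁ kx∈ˡ with _ , x∈ , refl ← ∈-map⁻ (zero ∷_) kx∈ˡ = zero∷ path-sound (reverse⁻ x∈)
  ... | inj₂ kx∈ʳ with k∈ , x∈ ← zigzag⁻ ks kx∈ʳ = k∈ ∷ path-sound x∈

  path-complete : ∀ {ks} {x : Vec _ n} → Admissible ks x → x ∈ path ks n
  path-complete []        = here refl
  path-complete (zero∷ x) = ∈-++⁺ˡ (∈-map⁺ (zero ∷_) (reverse⁺ (path-complete x)))
  path-complete {suc n} {ks} (k∈ ∷ x) =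
    ∈-++⁺ʳ (map (zero ∷_) (reverse (path all n))) (zigzag⁺ ks k∈ (path-complete x))

  module _ (all! : Unique (zero ∷ all)) (small! : Unique (zero ∷ small)) where

    path-unique : ∀ {ks} → Unique (zero ∷ ks) → ∀ n → Unique (path ks n)
    path-unique ks! zero    = [] ∷ []
    path-unique ks! (suc n) =
      block++zigzag-unique ks! (Unique-reverse⁺ (path-unique all! n)) (path-unique small! n)

  module _ (all~ : Linked _~_ (zero ∷ all)) (small~ : Linked _~_ (zero ∷ small)) where

    -- The start `s` is chosen before `ks`: the induction step needs the walks for `all` and for
    -- `small` to share it.
    path-walk : ∀ n → ∃[ s ] (∀ {ks} → Linked _~_ (zero ∷ ks) →
                ∃[ e ] Walk Close s e (path ks n))
    path-walk zero = [] , λ _ → [] , [-]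
    path-walk (suc n)
      with s , walks ← path-walk n
      with e , w ← walks all~ | _ , w′ ← walks small~
      -- Reversed, `w` leads from `e` to `s`, which is where `w′` starts.
      = zero ∷ e , λ ks~ → zigzag-walk ks~
          (Walk-map⁺ (λ {p} {q} → Close-∷ zero {p} {q})
            (Walk-reverse⁺ (λ {p} {q} → Close-sym {x = p} {q}) w))
          w′

-- The parameter a of the cube is `suc a` here.
module Letters (a b : ℕ) where

  private
    K = a + b

  all small : List (Fin (suc K))
  all   = tabulate suc
  small = tabulate (λ (i : Fin a) → suc i ↑ˡ b)

  ∈-all : ∀ k → suc k ∈ all
  ∈-all = ∈-tabulate⁺ {f = suc}

  ∈-small⁺ : ∀ {k} → toℕ k < a → suc k ∈ small
  ∈-small⁺ {k} k<a = subst (λ l → suc l ∈ small) eq (∈-tabulate⁺ (fromℕ< k<a))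
    where
    eq : fromℕ< k<a ↑ˡ b ≡ k
    eq = toℕ-injective (trans (toℕ-↑ˡ (fromℕ< k<a) b) (toℕ-fromℕ< k<a))

  ∈-small⁻ : ∀ {k} → k ∈ small → toℕ k < suc a
  ∈-small⁻ k∈ with i , refl ← ∈-tabulate⁻ k∈ =
    subst (_< suc a) (sym (toℕ-↑ˡ (suc i) b)) (toℕ<n (suc i))

  all! : Unique (zero ∷ all)
  -- `zero ∷ all` unfolds to `tabulate id`; likewise `zero ∷ small` is the tabulation of `_↑ˡ b`
  -- over `Fin (suc a)`.
  all! = Uniqueₚ.tabulate⁺ {f = id} id

  small! : Unique (zero ∷ small)
  small! = Uniqueₚ.tabulate⁺ {f = λ (i : Fin (suc a)) → i ↑ˡ b} (↑ˡ-injective b _ _)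

  consecutive : ∀ m → ∣ m - suc m ∣ ≡ 1
  consecutive zero    = refl
  consecutive (suc m) = consecutive m

  all~ : Linked _~_ (zero ∷ all)
  all~ = Linked-tabulate⁺ id λ i →
    trans (cong (λ m → ∣ m - suc (toℕ i) ∣) (toℕ-inject₁ i)) (consecutive (toℕ i))

  small~ : Linked _~_ (zero ∷ small)
  small~ = Linked-tabulate⁺ (λ (i : Fin (suc a)) → i ↑ˡ b) λ i →
    trans (cong₂ ∣_-_∣ (trans (toℕ-↑ˡ (inject₁ i) b) (toℕ-inject₁ i)) (toℕ-↑ˡ (suc i) b))
          (consecutive (toℕ i))

  open Paths all small public

  AfterZero : Vec (Fin (suc K)) n → Fin n → Set
  AfterZero x i = ∃[ j ] (toℕ i ≡ suc (toℕ j) × toℕ (lookup x j) ≡ 0)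

  -- Dropping a first letter 0 can leave a large letter in front without its predecessor; the left
  -- alternative makes room for this, so that induction on the string is possible.
  Justified : List (Fin (suc K)) → Vec (Fin (suc K)) n → Set
  Justified ks x = ∀ i → suc a ≤ toℕ (lookup x i) →
    (toℕ i ≡ 0 × lookup x i ∈ ks) ⊎ AfterZero x i

  AfterZero-∷ : ∀ {k} {x : Vec _ n} {i} → AfterZero x i → AfterZero (k ∷ x) (suc i)
  AfterZero-∷ (j , i≡1+j , xⱼ≡0) = suc j , cong suc i≡1+j , xⱼ≡0

  admissible⇒justified : ∀ {ks} {x : Vec _ n} → Admissible ks x → Justified ks x
  admissible⇒justified (zero∷ x) (suc i) large with admissible⇒justified x i large
  ... | inj₁ (i≡0 , _) = inj₂ (zero , cong suc i≡0 , refl)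
  ... | inj₂ after     = inj₂ (AfterZero-∷ after)
  admissible⇒justified (k∈ ∷ x) zero    large = inj₁ (refl , k∈)
  admissible⇒justified (k∈ ∷ x) (suc i) large with admissible⇒justified x i large
  ... | inj₁ (_ , xᵢ∈) = contradiction large (<⇒≱ (∈-small⁻ xᵢ∈))
  ... | inj₂ after     = inj₂ (AfterZero-∷ after)

  justified-zero∷⁻ : ∀ {ks} {x : Vec _ n} → Justified ks (zero ∷ x) → Justified all x
  justified-zero∷⁻ {x = x} h i large with h (suc i) large
  ... | inj₂ (suc j , i≡1+j , xⱼ≡0) = inj₂ (j , suc-injective i≡1+j , xⱼ≡0)
  -- The 0 in question is the removed letter. The letter after it is large, hence nonzero, hence in
  -- `all`.
  ... | inj₂ (zero  , i≡0   , _)    with suc k ← lookup x i =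
    inj₁ (suc-injective i≡0 , ∈-all k)

  justified-suc∷⁻ : ∀ {ks k} {x : Vec _ n} → Justified ks (suc k ∷ x) → Justified small x
  justified-suc∷⁻ h i large with h (suc i) large
  -- The removed letter is nonzero, so the justifying 0 lies in the tail.
  ... | inj₂ (suc j , i≡1+j , xⱼ≡0) = inj₂ (j , suc-injective i≡1+j , xⱼ≡0)

  -- `Justified` constrains large letters only; a nonzero first letter that is not large reaches
  -- `ks` through the inclusion.
  justified⇒admissible : ∀ {ks} {x : Vec _ n} → small ⊆ ks → Justified ks x → Admissible ks x
  justified⇒admissible {x = []}       _    _ = []
  justified⇒admissible {x = zero ∷ _} _    h =
    zero∷ justified⇒admissible small⊆all (justified-zero∷⁻ h)
    where
    small⊆all : small ⊆ all
    small⊆all k∈ with i , refl ← ∈-tabulate⁻ k∈ = ∈-all (i ↑ˡ b)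
  justified⇒admissible {ks = ks} {x = suc k ∷ _} sub h =
    first∈ ∷ justified⇒admissible id (justified-suc∷⁻ h)
    where
    first∈ : suc k ∈ ks
    first∈ with suc a ≤? suc (toℕ k)
    ... | no ¬large with s≤s k<a ← ≰⇒> ¬large = sub (∈-small⁺ k<a)
    ... | yes large with inj₁ (_ , k∈) ← h zero large = k∈

  admissible⇒valid : {x : Vec _ n} → Admissible small x → LargeOnlyAfterZero (suc a) b x
  admissible⇒valid x i large with admissible⇒justified x i large
  ... | inj₁ (_ , xᵢ∈) = contradiction large (<⇒≱ (∈-small⁻ xᵢ∈))
  ... | inj₂ after     = after

  valid⇒admissible : {x : Vec _ n} → LargeOnlyAfterZero (suc a) b x → Admissible small x
  valid⇒admissible h = justified⇒admissible id (λ i → inj₂ ∘ h i)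

-- From lists of strings to paths in the cube.

toHoradamStrings : ∀ {a b} {xs : List (Vec (Fin (a + b)) n)} → All (LargeOnlyAfterZero a b) xs →
                   ∃[ vs ] map (string {a} {b}) vs ≡ xs
toHoradamStrings []         = [] , refl
toHoradamStrings (c ∷ cs) with vs , refl ← toHoradamStrings cs = mkHoradamString _ c ∷ vs , refl

hamiltonianPath : ∀ {a b n} (xs : List (Vec (Fin (a + b)) n)) →
  Linked Close xs → Unique xs → (∀ {x} → x ∈ xs → LargeOnlyAfterZero a b x) →
  (∀ {x} → LargeOnlyAfterZero a b x → x ∈ xs) → HasHamiltonianPath (horadamCube a b n)
hamiltonianPath {a} {b} {n} xs linked unique sound complete
  with vs , refl ← toHoradamStrings {a = a} {b} (All.tabulate {xs = xs} sound) = vs , record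
  { consecutive-adjacent = Linkedₚ.map⁻ linked
  ; no-repetition        = Uniqueₚ.map⁻ unique
  ; visits-all           = visits
  }
  where
  open DecMembership (≡-dec {n = n} (_≟_ {a + b})) using (_∈?_)

  visits : ∀ v → v ∈ vs
  visits (mkHoradamString x c)
    -- As `c` is irrelevant, `complete c` may be used only irrelevantly; decidable membership
    -- recovers a usable proof.
    with _ , v∈ , refl ← ∈-map⁻ string (recompute (x ∈? map string vs) (complete c)) = v∈

theorem14 : ∀ (a b n : ℕ) → 1 ≤ a → 1 ≤ b → 1 ≤ n → HasHamiltonianPath (horadamCube a b n)
theorem14 (suc a) b n _ _ _ =
  -- The first letter of a Horadam string has no predecessor, so it is 0 or in `small`.
  hamiltonianPath (path small n)
    (Walk⇒Linked (proj₂ (proj₂ (path-walk all~ small~ n) small~)))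
    (path-unique all! small! small! n)
    (admissible⇒valid ∘ path-sound)
    (path-complete ∘ valid⇒admissible)
  where open Letters a b
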